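{- Let $\psi\in\mathcal L$ be well-formed, let $\tau$ be a trace, and let $\sigma=\mathsf{seq}_\psi(\tau)$. Then $\psi^+(\sigma)\equiv\top$ if and only if $\tau\models\psi$.
   Context: Syntax. Fix a multi-sorted signature $\Sigma=\langle\mathcal S,\mathcal P,\mathcal F,V\rangle$ with a finite non-empty set $V$ of sorted data variables. Each $v\in V$ has a lookback variable $\overleftarrow v$, and $\overleftarrow V=\{\overleftarrow v\mid v\in V\}$. Terms are $t::=v\mid\overleftarrow v\mid f(t_1,\dots,t_k)$; atoms are $p(t_1,\dots,t_k)$. First-order formulas are $\phi::=\top\mid\bot\mid a\mid\neg a\mid\phi\wedge\phi\mid\phi\vee\phi$. Properties are $\psi::=\phi\mid\psi\wedge\psi\mid\psi\vee\psi\mid\mathsf X\psi\mid\mathsf X_{\mathsf w}\psi\mid\psi\mathsf U\psi\mid\psi\mathsf R\psi$, forming the set $\mathcal L$; $\mathit{foa}(\psi)$ is the set of atoms of $\psi$. Semantics. A trace is $\tau=(M,\langle\alpha_0,\dots,\alpha_{n-1}\rangle)$ with $M$ a $\Sigma$-structure and $\alpha_i$ assignments on $V$. A term is well-defined at $i$ if $0<i<n$, or $i=0$ and it has no lookback variable. $v$ evaluates to $\alpha_i(v)$ and $\overleftarrow v$ to $\alpha_{i-1}(v)$. - $\tau,i\models p(t_1,\dots,t_k)$ iff some $t_j$ is not well-defined at $i$, or the evaluated tuple is in $p^M$; $\tau,i\models\neg a$ iff $\tau,i\not\models a$. - $\wedge$ and $\vee$ are as usual. - $\mathsf X\psi$: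 $i<n-1$ and $\psi$ holds at $i+1$. - $\mathsf X_{\mathsf w}\psi$: $i=n-1$ or $\psi$ holds at $i+1$. - $\psi_1\mathsf U\psi_2$: some $j\in[i,n)$ has $\psi_2$, with $\psi_1$ on $[i,j)$. - $\psi_1\mathsf R\psi_2$: $\psi_2$ holds on $[i,n)$, or some $j\in[i,n)$ has $\psi_1$ with $\psi_2$ on $[i,j]$. $\tau\models\psi$ iff $\tau,0\models\psi$. For assignments $\alpha,\alpha'$ on $V$, $\alpha\rhd\alpha'$ maps $\overleftarrow v\mapsto\alpha(v)$ and $v\mapsto\alpha'(v)$. Normal forms. - $\mathit{last}$ is a dedicated proposition meant to hold only at the last instant. - $\mathsf{tnps}(\psi)=\{\psi\}$ if $\psi$ is a (negated) atom or rooted by a temporal operator, and $\mathsf{tnps}(\psi_1\wedge\psi_2)=\mathsf{tnps}(\psi_1\vee\psi_2)=\mathsf{tnps}(\psi_1)\cup\mathsf{tnps}(\psi_2)$. - $\mathsf{xnf}$ fixes literals, $\top$, $\bot$ and $\mathsf X$/$\mathsf X_{\mathsf w}$-rooted properties, commutes with $\wedge$ and $\vee$, and satisfies $\mathsf{xnf}(\psi_1\mathsf U\psi_2)=\mathsf{xnf}(\psi_2)\vee(\mathsf{xnf}(\psi_1)\wedge\mathsf X(\psi_1\mathsf U\psi_2))$ and $\mathsf{xnf}(\psi_1\mathsf R\psi_2)=(\mathsf{xnf}(\psi_2)\vee\mathit{last})\wedge(\mathsf{xnf}(\psi_1)\vee\mathsf X_{\mathsf w}(\psi_1\mathsf R\psi_2))$.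 - $\psi$ is well-formed if no (negated) atom in $\mathsf{tnps}(\mathsf{xnf}(\psi))$ contains a lookback variable. Progression. For a set of atoms $A$, $\psi^+(A)$ is defined by: - an atom $a$ maps to $\top$ if $a\in A$ and to $\bot$ otherwise; $\neg a$ maps to $\bot$ if $a\in A$ and to $\top$ otherwise; - $^+$ commutes with $\wedge$ and $\vee$; - $(\mathsf X\psi_1)^+(A)=\psi_1\wedge\neg\mathit{last}$, and $(\mathsf X_{\mathsf w}\psi_1)^+(A)=\psi_1\vee\mathit{last}$; - $(\psi_1\mathsf U\psi_2)^+(A)=\psi_2^+(A)\vee(\psi_1^+(A)\wedge(\mathsf X(\psi_1\mathsf U\psi_2))^+(A))$; - $(\psi_1\mathsf R\psi_2)^+(A)=\psi_2^+(A)\wedge(\psi_1^+(A)\vee(\mathsf X_{\mathsf w}(\psi_1\mathsf R\psi_2))^+(A))$. On sequences, $\psi^+(\epsilon)=\psi$ and $\psi^+(A\rho)=(\psi^+(A))^+(\rho)$. $\equiv$ is propositional equivalence, with atoms, $\mathit{last}$ and temporally-rooted subproperties treated as opaque propositions. Corresponding atom sequence. $\mathsf{seq}_\psi(\tau)=\langle A_0,\dots,A_{n-1}\rangle$, where: - $A_0=\{a\in\mathit{foa}(\psi)\mid a$ contains no lookback variable and $M,\alpha_0\models a\}$; - $A_i=\{a\in\mathit{foa}(\psi)\mid M,\alpha_{i-1}\rhd\alpha_i\models a\}$ for $0<i<n$.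
   Formalization: Equivalence to ⊤ is taken under the assumption that last is true: with last opaque the claim fails (X_w a on a one-instant trace progresses to a ∨ last). Membership in the sets A_i is assumed decidable, as excluded middle gives. -}

module Defs where

open import Level using (0ℓ)
open import Data.Bool as Bool using (Bool; true; false; if_then_else_)
open import Data.Empty using () renaming (⊥ to Empty)
open import Data.Fin using (Fin; zero; suc; toℕ; fromℕ<; pred)
open import Data.List using (List; []; _∷_; _++_; [_]; foldl)
open import Data.List.Membership.Propositional using (_∈_)
open import Data.List.Relation.Unary.All using (All; []; _∷_; lookup)
open import Data.Nat using (ℕ; suc; _≤_; _<_)
open import Data.Product using (Σ; Σ-syntax; ∃₂; _×_; _,_)
open import Data.Sum using (_⊎_)
open import Data.Unit using () renaming (⊤ to Unit)
open import Function.Bundles using (_↔_)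
open import Relation.Binary.PropositionalEquality using (_≡_)
open import Relation.Nullary using (¬_; does)
open import Relation.Unary using (Pred; Decidable)

record Signature : Set₁ where
  field
    Sort     : Set
    Pr       : Set
    Fn       : Set
    arity    : Pr → List Sort
    dom      : Fn → List Sort
    cod      : Fn → Sort
    V        : Set
    sort     : V → Sort
    ∣V∣-1    : ℕ
    V-finite : V ↔ Fin (suc ∣V∣-1)

data LVar (V : Set) : Set where
  now  : V → LVar V
  prev : V → LVar V

module _ (S : Signature) where
  open Signature S

  lsort : LVar V → Sort
  lsort (now v)  = sort v
  lsort (prev v) = sort v

  data Term : Sort → Set where
    var : (x : LVar V) → Term (lsort x)
    app : (f : Fn) → All Term (dom f) → Term (cod f)

  data Atom : Set where
    rel : (p : Pr) → All Term (arity p) → Atom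

  -- The atoms of Σ together with the dedicated proposition last.
  data Atom⁺ : Set where
    ⌊_⌋  : Atom → Atom⁺
    last : Atom⁺

infixr 6 _∧_
infixr 5 _∨_
infixr 7 _U_ _R_

-- The first-order layer consists of the properties without temporal operators.
data Property (A : Set) : Set where
  ⊤ ⊥       : Property A
  atom ¬atom : A → Property A
  _∧_ _∨_   : Property A → Property A → Property A
  X Xʷ      : Property A → Property A
  _U_ _R_   : Property A → Property A → Property A

mapᴾ : {A B : Set} → (A → B) → Property A → Property B
mapᴾ g ⊤         = ⊤
mapᴾ g ⊥         = ⊥
mapᴾ g (atom a)  = atom (g a)
mapᴾ g (¬atom a) = ¬atom (g a)
mapᴾ g (φ ∧ χ)   = mapᴾ g φ ∧ mapᴾ g χ
mapᴾ g (φ ∨ χ)   = mapᴾ g φ ∨ mapᴾ g χ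
mapᴾ g (X φ)     = X (mapᴾ g φ)
mapᴾ g (Xʷ φ)    = Xʷ (mapᴾ g φ)
mapᴾ g (φ U χ)   = mapᴾ g φ U mapᴾ g χ
mapᴾ g (φ R χ)   = mapᴾ g φ R mapᴾ g χ

foa : {A : Set} → Property A → List A
foa ⊤         = []
foa ⊥         = []
foa (atom a)  = [ a ]
foa (¬atom a) = [ a ]
foa (φ ∧ χ)   = foa φ ++ foa χ
foa (φ ∨ χ)   = foa φ ++ foa χ
foa (X φ)     = foa φ
foa (Xʷ φ)    = foa φ
foa (φ U χ)   = foa φ ++ foa χ
foa (φ R χ)   = foa φ ++ foa χ

-- ℒ S is the set of properties proper; last occurs only in ℒ⁺ S, where
-- normal forms and progression take their values.
ℒ ℒ⁺ : Signature → Set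
ℒ  S = Property (Atom S)
ℒ⁺ S = Property (Atom⁺ S)

module _ {S : Signature} where
  open Signature S

  embed : ℒ S → ℒ⁺ S
  embed = mapᴾ ⌊_⌋

  data HasLookback : {s : Sort} → Term S s → Set where
    here : (v : V) → HasLookback (var (prev v))
    arg  : {f : Fn} {ts : All (Term S) (dom f)} {s : Sort} (j : s ∈ dom f) →
           HasLookback (lookup ts j) → HasLookback (app f ts)

  HasLookbackᵃ : Atom S → Set
  HasLookbackᵃ (rel p ts) = ∃₂ λ s (j : s ∈ arity p) → HasLookback (lookup ts j)

record Structure (S : Signature) : Set₁ where
  open Signature S
  field
    ⟦_⟧  : Sort → Set
    fnᴹ  : (f : Fn) → All ⟦_⟧ (dom f) → ⟦ cod f ⟧
    relᴹ : (p : Pr) → Pred (All ⟦_⟧ (arity p)) 0ℓ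

module _ {S : Signature} (M : Structure S) where
  open Signature S
  open Structure M

  Assignment : Set
  Assignment = (v : V) → ⟦ sort v ⟧

  LAssignment : Set
  LAssignment = (x : LVar V) → ⟦ lsort S x ⟧

  _▹_ : Assignment → Assignment → LAssignment
  (α ▹ α′) (prev v) = α v
  (α ▹ α′) (now v)  = α′ v

  eval  : {s : Sort} → LAssignment → Term S s → ⟦ s ⟧
  evals : {ss : List Sort} → LAssignment → All (Term S) ss → All ⟦_⟧ ss
  eval ρ (var x)    = ρ x
  eval ρ (app f ts) = fnᴹ f (evals ρ ts)
  evals ρ []        = []
  evals ρ (t ∷ ts)  = eval ρ t ∷ evals ρ ts

  _⊨ᵃ_ : LAssignment → Atom S → Set
  ρ ⊨ᵃ rel p ts = relᴹ p (evals ρ ts)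

record Trace (S : Signature) : Set₁ where
  field
    M   : Structure S
    n-1 : ℕ
  n : ℕ
  n = suc n-1
  field
    α : Fin n → Assignment M

module _ {S : Signature} (τ : Trace S) where
  open Signature S
  open Trace τ

  -- At instant 0 the junk value pred 0 = 0 supplies the lookback part; there
  -- this environment is only relevant to terms without lookback variables.
  env : Fin n → LAssignment M
  env i = _▹_ M (α (pred i)) (α i)

  WellDefined : {s : Sort} → Fin n → Term S s → Set
  WellDefined i t = (0 < toℕ i) ⊎ (toℕ i ≡ 0 × ¬ HasLookback t)

  HoldsAtom : Fin n → Atom S → Set
  HoldsAtom i (rel p ts) =
    (∃₂ λ s (j : s ∈ arity p) → ¬ WellDefined i (lookup ts j))
    ⊎ _⊨ᵃ_ M (env i) (rel p ts)

  Holds : Fin n → ℒ S → Set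
  Holds i ⊤         = Unit
  Holds i ⊥         = Empty
  Holds i (atom a)  = HoldsAtom i a
  Holds i (¬atom a) = ¬ HoldsAtom i a
  Holds i (φ ∧ χ)   = Holds i φ × Holds i χ
  Holds i (φ ∨ χ)   = Holds i φ ⊎ Holds i χ
  Holds i (X φ)     = Σ[ i<n-1 ∈ suc (toℕ i) < n ] Holds (fromℕ< i<n-1) φ
  Holds i (Xʷ φ)    = suc (toℕ i) ≡ n
                      ⊎ (Σ[ i<n-1 ∈ suc (toℕ i) < n ] Holds (fromℕ< i<n-1) φ)
  Holds i (φ U χ)   = Σ[ j ∈ Fin n ] toℕ i ≤ toℕ j × Holds j χ
                      × (∀ k → toℕ i ≤ toℕ k → toℕ k < toℕ j → Holds k φ)
  Holds i (φ R χ)   = (∀ k → toℕ i ≤ toℕ k → Holds k χ)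
                      ⊎ (Σ[ j ∈ Fin n ] toℕ i ≤ toℕ j × Holds j φ
                         × (∀ k → toℕ i ≤ toℕ k → toℕ k ≤ toℕ j → Holds k χ))

infix 4 _⊨_
_⊨_ : {S : Signature} → Trace S → ℒ S → Set
τ ⊨ ψ = Holds τ zero ψ

module _ {S : Signature} where

  xnf : ℒ⁺ S → ℒ⁺ S
  xnf ⊤         = ⊤
  xnf ⊥         = ⊥
  xnf (atom a)  = atom a
  xnf (¬atom a) = ¬atom a
  xnf (φ ∧ χ)   = xnf φ ∧ xnf χ
  xnf (φ ∨ χ)   = xnf φ ∨ xnf χ
  xnf (X φ)     = X φ
  xnf (Xʷ φ)    = Xʷ φ
  xnf (φ U χ)   = xnf χ ∨ (xnf φ ∧ X (φ U χ))
  xnf (φ R χ)   = (xnf χ ∨ atom last) ∧ (xnf φ ∨ Xʷ (φ R χ))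

  tnps : ℒ⁺ S → List (ℒ⁺ S)
  tnps ⊤       = []
  tnps ⊥       = []
  tnps (φ ∧ χ) = tnps φ ++ tnps χ
  tnps (φ ∨ χ) = tnps φ ++ tnps χ
  tnps φ       = [ φ ]

  WellFormed : ℒ S → Set
  WellFormed ψ = ∀ a →
    atom ⌊ a ⌋ ∈ tnps (xnf (embed ψ)) ⊎ ¬atom ⌊ a ⌋ ∈ tnps (xnf (embed ψ)) →
    ¬ HasLookbackᵃ a

-- Decidability of membership makes "⊤ if a ∈ A and ⊥ otherwise" a function;
-- classically every set qualifies.
AtomSet : Signature → Set₁
AtomSet S = Σ (Pred (Atom S) 0ℓ) Decidable

module _ {S : Signature} where

  -- last is not an atom of Σ, hence belongs to no set of atoms: progressing
  -- an occurrence of last past a further instant makes it false, the instant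
  -- at which that occurrence was introduced not being the last one.
  member? : Atom⁺ S → AtomSet S → Bool
  member? ⌊ a ⌋ (_ , A?) = does (A? a)
  member? last  _        = false

  nextˢ nextʷ : ℒ⁺ S → ℒ⁺ S
  nextˢ φ = φ ∧ ¬atom last
  nextʷ φ = φ ∨ atom last

  infixl 8 _⁺[_] _⁺⟨_⟩

  _⁺[_] : ℒ⁺ S → AtomSet S → ℒ⁺ S
  ⊤         ⁺[ A ] = ⊤
  ⊥         ⁺[ A ] = ⊥
  atom a    ⁺[ A ] = if member? a A then ⊤ else ⊥
  (¬atom a) ⁺[ A ] = if member? a A then ⊥ else ⊤
  (φ ∧ χ)   ⁺[ A ] = φ ⁺[ A ] ∧ χ ⁺[ A ]
  (φ ∨ χ)   ⁺[ A ] = φ ⁺[ A ] ∨ χ ⁺[ A ]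
  X φ       ⁺[ A ] = nextˢ φ
  Xʷ φ      ⁺[ A ] = nextʷ φ
  (φ U χ)   ⁺[ A ] = χ ⁺[ A ] ∨ (φ ⁺[ A ] ∧ nextˢ (φ U χ))
  (φ R χ)   ⁺[ A ] = χ ⁺[ A ] ∧ (φ ⁺[ A ] ∨ nextʷ (φ R χ))

  _⁺⟨_⟩ : ℒ⁺ S → List (AtomSet S) → ℒ⁺ S
  ψ ⁺⟨ ρ ⟩ = foldl _⁺[_] ψ ρ

  -- Only the values at atoms, last and temporally-rooted properties are used.
  Valuation : Set
  Valuation = ℒ⁺ S → Bool

  value : Valuation → ℒ⁺ S → Bool
  value ν ⊤         = true
  value ν ⊥         = false
  value ν (atom a)  = ν (atom a)
  value ν (¬atom a) = Bool.not (ν (atom a))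
  value ν (φ ∧ χ)   = value ν φ Bool.∧ value ν χ
  value ν (φ ∨ χ)   = value ν φ Bool.∨ value ν χ
  value ν φ         = ν φ

  -- Propositional equivalence under the assumption θ; plain propositional
  -- equivalence is the case θ = ⊤.  Once a whole trace has been consumed, the
  -- surviving occurrences of last refer to its last instant, where last holds,
  -- so the relevant assumption is θ = atom last.  Without it, Xʷ (atom a)
  -- progresses through a trace of length 1 to atom a ∨ atom last, which is not
  -- plainly equivalent to ⊤, although Xʷ (atom a) holds on that trace.
  infix 4 _⊩_≡ₚ_
  _⊩_≡ₚ_ : ℒ⁺ S → ℒ⁺ S → ℒ⁺ S → Set
  θ ⊩ φ ≡ₚ χ = ∀ ν → value ν θ ≡ true → value ν φ ≡ value ν χ

seq : {S : Signature} (ψ : ℒ S) (τ : Trace S) → Fin (Trace.n τ) → Pred (Atom S) 0ℓ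
seq ψ τ zero    a = a ∈ foa ψ × ¬ HasLookbackᵃ a × _⊨ᵃ_ (Trace.M τ) (env τ zero) a
seq ψ τ (suc i) a = a ∈ foa ψ × _⊨ᵃ_ (Trace.M τ) (env τ (suc i)) a

{-# OPTIONS --safe #-}
-- Progression commutes with ∧ and ∨, and a progressed U or R is its one-step
-- fixpoint expansion, guarded by last.  An occurrence of last becomes false as
-- soon as another instant is consumed and is true otherwise, so the guards tell
-- exactly whether a next instant exists.  Hence, by induction on the remaining
-- instants and the property, the truth value of the fully progressed property
-- reflects satisfaction, independently of the valuation of everything but last.
-- Well-formedness matters only at instant 0, where it makes the sets seq agree
-- with satisfaction of atoms.
module Submission where

open import Defs
open import Data.Bool as Bool using (Bool; true; false; not; if_then_else_)
open import Data.Bool.Properties using (∧-identityʳ; ∧-zeroʳ; ∨-identityʳ; ∨-zeroʳ)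
open import Data.Empty using (⊥-elim)
open import Data.Fin using (Fin; zero; suc; toℕ; fromℕ<)
open import Data.Fin.Properties using (toℕ-fromℕ<; toℕ-injective; toℕ<n)
open import Data.List using (List; []; _∷_; tabulate)
open import Data.List.Membership.Propositional using (_∈_)
open import Data.List.Membership.Propositional.Properties using (∈-++⁺ˡ; ∈-++⁺ʳ)
open import Data.List.Relation.Binary.Subset.Propositional using (_⊆_)
open import Data.List.Relation.Unary.Any using (here)
open import Data.Nat using (ℕ; zero; suc; _≤_; _<_; s≤s; z≤n)
open import Data.Nat.Properties
  using (≤-refl; ≤-reflexive; ≤-trans; ≤-<-trans; <⇒≤; <-irrefl;
         m≤n⇒m<n∨m≡n; ≤⇒≯; ≤-antisym)
open import Data.Product using (_×_; _,_; proj₂)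
open import Data.Sum using (_⊎_; inj₁; inj₂; [_,_]; map₂)
open import Data.Unit using (tt)
open import Function using (_∘_; id)
open import Function.Bundles using (_⇔_; mk⇔; Equivalence)
open import Relation.Binary.PropositionalEquality
  using (_≡_; refl; sym; trans; cong; subst)
open import Relation.Nullary using (¬_; proof; contradiction)
open import Relation.Nullary.Reflects
  using (Reflects; ofʸ; ofⁿ; invert; ¬-reflects; _×-reflects_; _⊎-reflects_)
open import Relation.Unary using (Decidable)

reflects-map : {P Q : Set} {b : Bool} → P ⇔ Q → Reflects P b → Reflects Q b
reflects-map P⇔Q (ofʸ p)  = ofʸ (Equivalence.to P⇔Q p)
reflects-map P⇔Q (ofⁿ ¬p) = ofⁿ (¬p ∘ Equivalence.from P⇔Q)

reflects-true : {P : Set} {b : Bool} → Reflects P b → P → b ≡ true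
reflects-true (ofʸ _)  p = refl
reflects-true (ofⁿ ¬p) p = contradiction p ¬p

-- Rest f i ρ: the list ρ enumerates the values of f strictly after i.
data Rest {B : Set₁} {n : ℕ} (f : Fin n → B) (i : Fin n) : List B → Set₁ where
  final : suc (toℕ i) ≡ n → Rest f i []
  step  : ∀ {ρ} (i<n-1 : suc (toℕ i) < n) → Rest f (fromℕ< i<n-1) ρ →
          Rest f i (f (fromℕ< i<n-1) ∷ ρ)

rest-suc : ∀ {B : Set₁} {n} {f : Fin (suc n) → B} {i ρ} →
           Rest (f ∘ suc) i ρ → Rest f (suc i) ρ
rest-suc (final eq)  = final (cong suc eq)
rest-suc (step lt r) = step (s≤s lt) (rest-suc r)

rest-tabulate : ∀ {B : Set₁} m (f : Fin (suc m) → B) →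
                Rest f zero (tabulate (f ∘ suc))
rest-tabulate zero    f = final refl
rest-tabulate (suc m) f =
  step (s≤s (s≤s z≤n)) (rest-suc (rest-tabulate m (f ∘ suc)))

module _ {n : ℕ} {i : Fin n} where

  ≤-split : ∀ {k : Fin n} → toℕ i ≤ toℕ k → toℕ i < toℕ k ⊎ i ≡ k
  ≤-split i≤k = map₂ toℕ-injective (m≤n⇒m<n∨m≡n i≤k)

  module _ (i<n-1 : suc (toℕ i) < n) {k : Fin n} where

    next≤⇒< : toℕ (fromℕ< i<n-1) ≤ toℕ k → toℕ i < toℕ k
    next≤⇒< = subst (_≤ toℕ k) (toℕ-fromℕ< i<n-1)

    <⇒next≤ : toℕ i < toℕ k → toℕ (fromℕ< i<n-1) ≤ toℕ k
    <⇒next≤ = subst (_≤ toℕ k) (sym (toℕ-fromℕ< i<n-1))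

  final-unique : suc (toℕ i) ≡ n → ∀ {k : Fin n} → toℕ i ≤ toℕ k → i ≡ k
  final-unique eq {k} i≤k with ≤-split i≤k
  ... | inj₁ i<k = contradiction (≤-trans (toℕ<n k) (≤-reflexive (sym eq))) (≤⇒≯ i<k)
  ... | inj₂ i≡k = i≡k

  -- `Q` stands for an upper bound on `k`, so that one backward extension serves both `U`, with
  -- `k < j`, and `R`, with `k ≤ j`.
  from-next : {P : Fin n → Set} (i<n-1 : suc (toℕ i) < n) → P i →
              {Q : Fin n → Set} →
              (∀ k → toℕ (fromℕ< i<n-1) ≤ toℕ k → Q k → P k) →
              ∀ k → toℕ i ≤ toℕ k → Q k → P k
  from-next i<n-1 pi ps k i≤k q with ≤-split i≤k
  ... | inj₁ i<k  = ps k (<⇒next≤ i<n-1 i<k) q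
  ... | inj₂ refl = pi

module _ {S : Signature} (τ : Trace S) (i : Fin (Trace.n τ)) (φ χ : ℒ S) where

  -- The left side has the shape of the progression clause, so reflection can be proved there and
  -- transported. The witness `j` is either `i` or lies beyond it.
  U-unfold : Holds τ i (χ ∨ (φ ∧ X (φ U χ))) ⇔ Holds τ i (φ U χ)
  U-unfold = mk⇔ to from
    where
    to : Holds τ i (χ ∨ (φ ∧ X (φ U χ))) → Holds τ i (φ U χ)
    to (inj₁ hχ) = i , ≤-refl , hχ , λ k i≤k k<i → contradiction k<i (≤⇒≯ i≤k)
    to (inj₂ (hφ , lt , j , next≤j , hχ , hφs)) =
      j , <⇒≤ (next≤⇒< lt next≤j) , hχ , from-next lt hφ hφs

    from : Holds τ i (φ U χ) → Holds τ i (χ ∨ (φ ∧ X (φ U χ)))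
    from (j , i≤j , hχ , hφs) with ≤-split i≤j
    ... | inj₂ refl = inj₁ hχ
    ... | inj₁ i<j  = inj₂ (hφs i ≤-refl i<j , lt , j , <⇒next≤ lt i<j , hχ ,
                            λ k next≤k → hφs k (<⇒≤ (next≤⇒< lt next≤k)))
      where lt = ≤-<-trans i<j (toℕ<n j)

  R-unfold : Holds τ i (χ ∧ (φ ∨ Xʷ (φ R χ))) ⇔ Holds τ i (φ R χ)
  R-unfold = mk⇔ to from
    where
    to : Holds τ i (χ ∧ (φ ∨ Xʷ (φ R χ))) → Holds τ i (φ R χ)
    to (hχ , inj₁ hφ) =
      inj₂ (i , ≤-refl , hφ , λ k i≤k k≤i →
        subst (λ l → Holds τ l χ) (toℕ-injective (≤-antisym i≤k k≤i)) hχ)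
    to (hχ , inj₂ (inj₁ eq)) =
      inj₁ λ k i≤k → subst (λ l → Holds τ l χ) (final-unique eq i≤k) hχ
    to (hχ , inj₂ (inj₂ (lt , inj₁ hχs))) =
      -- No upper bound on `k` applies here, so `Q` is chosen as the fact that `i≤k` already proves.
      inj₁ λ k i≤k → from-next lt hχ {λ _ → toℕ i ≤ toℕ k} (λ l le _ → hχs l le) k i≤k i≤k
    to (hχ , inj₂ (inj₂ (lt , inj₂ (j , next≤j , hφ , hχs)))) =
      inj₂ (j , <⇒≤ (next≤⇒< lt next≤j) , hφ , from-next lt hχ hχs)

    from : Holds τ i (φ R χ) → Holds τ i (χ ∧ (φ ∨ Xʷ (φ R χ)))
    -- Without a releasing instant, the two disjuncts of `Xʷ` correspond to `i` being the last
    -- instant or having a successor.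
    from (inj₁ hχs) with m≤n⇒m<n∨m≡n (toℕ<n i)
    ... | inj₂ eq = hχs i ≤-refl , inj₂ (inj₁ eq)
    ... | inj₁ lt = hχs i ≤-refl ,
      inj₂ (inj₂ (lt , inj₁ λ k next≤k → hχs k (<⇒≤ (next≤⇒< lt next≤k))))
    from (inj₂ (j , i≤j , hφ , hχs)) with ≤-split i≤j
    ... | inj₂ refl = hχs i ≤-refl ≤-refl , inj₁ hφ
    ... | inj₁ i<j  = hχs i ≤-refl i≤j ,
      inj₂ (inj₂ (lt , inj₂ (j , <⇒next≤ lt i<j , hφ ,
        λ k next≤k → hχs k (<⇒≤ (next≤⇒< lt next≤k)))))
      where lt = ≤-<-trans i<j (toℕ<n j)

module _ {S : Signature} (ν : Valuation {S}) where

  value-∧ : ∀ ρ (φ χ : ℒ⁺ S) →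
            value ν ((φ ∧ χ) ⁺⟨ ρ ⟩) ≡ value ν (φ ⁺⟨ ρ ⟩) Bool.∧ value ν (χ ⁺⟨ ρ ⟩)
  value-∧ []      φ χ = refl
  value-∧ (A ∷ ρ) φ χ = value-∧ ρ (φ ⁺[ A ]) (χ ⁺[ A ])

  value-∨ : ∀ ρ (φ χ : ℒ⁺ S) →
            value ν ((φ ∨ χ) ⁺⟨ ρ ⟩) ≡ value ν (φ ⁺⟨ ρ ⟩) Bool.∨ value ν (χ ⁺⟨ ρ ⟩)
  value-∨ []      φ χ = refl
  value-∨ (A ∷ ρ) φ χ = value-∨ ρ (φ ⁺[ A ]) (χ ⁺[ A ])

  value-⊤ : ∀ ρ → value ν (⊤ ⁺⟨ ρ ⟩) ≡ true
  value-⊤ []      = refl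
  value-⊤ (A ∷ ρ) = value-⊤ ρ

  value-⊥ : ∀ ρ → value ν (⊥ ⁺⟨ ρ ⟩) ≡ false
  value-⊥ []      = refl
  value-⊥ (A ∷ ρ) = value-⊥ ρ

  value-if : ∀ ρ b → value ν ((if b then ⊤ else ⊥) ⁺⟨ ρ ⟩) ≡ b
  value-if ρ true  = value-⊤ ρ
  value-if ρ false = value-⊥ ρ

  value-if-not : ∀ ρ b → value ν ((if b then ⊥ else ⊤) ⁺⟨ ρ ⟩) ≡ not b
  value-if-not ρ true  = value-⊥ ρ
  value-if-not ρ false = value-⊤ ρ

  reflects-∧ : ∀ {P Q : Set} ρ (φ χ : ℒ⁺ S) →
               Reflects P (value ν (φ ⁺⟨ ρ ⟩)) → Reflects Q (value ν (χ ⁺⟨ ρ ⟩)) →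
               Reflects (P × Q) (value ν ((φ ∧ χ) ⁺⟨ ρ ⟩))
  reflects-∧ ρ φ χ p q rewrite value-∧ ρ φ χ = p ×-reflects q

  reflects-∨ : ∀ {P Q : Set} ρ (φ χ : ℒ⁺ S) →
               Reflects P (value ν (φ ⁺⟨ ρ ⟩)) → Reflects Q (value ν (χ ⁺⟨ ρ ⟩)) →
               Reflects (P ⊎ Q) (value ν ((φ ∨ χ) ⁺⟨ ρ ⟩))
  reflects-∨ ρ φ χ p q rewrite value-∨ ρ φ χ = p ⊎-reflects q

module _ {S : Signature} (φ χ : ℒ S) where

  -- Serves `∨` as well: `xnf` and `tnps` treat both connectives alike, so the two hypotheses reduce
  -- to the same type.
  wf-∧ˡ : WellFormed (φ ∧ χ) → WellFormed φ
  wf-∧ˡ wf a = wf a ∘ [ inj₁ ∘ ∈-++⁺ˡ , inj₂ ∘ ∈-++⁺ˡ ]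

  wf-∧ʳ : WellFormed (φ ∧ χ) → WellFormed χ
  wf-∧ʳ wf a = wf a ∘ [ inj₁ ∘ ∈-++⁺ʳ _ , inj₂ ∘ ∈-++⁺ʳ _ ]

  wf-Uˡ : WellFormed (φ U χ) → WellFormed φ
  wf-Uˡ wf a = wf a ∘ [ inj₁ ∘ inφ , inj₂ ∘ inφ ]
    where
    inφ : tnps (xnf (embed φ)) ⊆ tnps (xnf (embed (φ U χ)))
    inφ = ∈-++⁺ʳ (tnps (xnf (embed χ))) ∘ ∈-++⁺ˡ

  wf-Uʳ : WellFormed (φ U χ) → WellFormed χ
  wf-Uʳ wf a = wf a ∘ [ inj₁ ∘ ∈-++⁺ˡ , inj₂ ∘ ∈-++⁺ˡ ]

  wf-Rˡ : WellFormed (φ R χ) → WellFormed φ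
  wf-Rˡ wf a = wf a ∘ [ inj₁ ∘ inφ , inj₂ ∘ inφ ]
    where
    inφ : tnps (xnf (embed φ)) ⊆ tnps (xnf (embed (φ R χ)))
    inφ = ∈-++⁺ʳ (tnps (xnf (embed χ) ∨ atom last)) ∘ ∈-++⁺ˡ

  wf-Rʳ : WellFormed (φ R χ) → WellFormed χ
  wf-Rʳ wf a = wf a ∘ [ inj₁ ∘ ∈-++⁺ˡ ∘ ∈-++⁺ˡ , inj₂ ∘ ∈-++⁺ˡ ∘ ∈-++⁺ˡ ]

-- `HoldsAtom` makes atoms with ill-defined terms true, while `seq` omits them. That disjunct is
-- refuted by the absence of lookback at instant 0 and by positivity later.
seq⇔HoldsAtom : {S : Signature} (ψ : ℒ S) (τ : Trace S) (i : Fin (Trace.n τ))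
                (a : Atom S) → a ∈ foa ψ → (toℕ i ≡ 0 → ¬ HasLookbackᵃ a) →
                seq ψ τ i a ⇔ HoldsAtom τ i a
seq⇔HoldsAtom ψ τ zero (rel p ts) a∈ψ ¬lb =
  mk⇔ (inj₂ ∘ proj₂ ∘ proj₂)
      [ (λ { (s , j , ¬wd) → ⊥-elim (¬wd (inj₂ (refl , λ lb → ¬lb refl (s , j , lb)))) })
      , (λ h → a∈ψ , ¬lb refl , h) ]
seq⇔HoldsAtom ψ τ (suc i) (rel p ts) a∈ψ ¬lb =
  mk⇔ (inj₂ ∘ proj₂)
      [ (λ { (s , j , ¬wd) → ⊥-elim (¬wd (inj₁ (s≤s z≤n))) }) , (a∈ψ ,_) ]

module Progression {S : Signature} (ψ : ℒ S) (τ : Trace S)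
                   (seq? : ∀ i → Decidable (seq ψ τ i))
                   (ν : Valuation {S}) (ν-last : ν (atom last) ≡ true) where

  σ : Fin (Trace.n τ) → AtomSet S
  σ i = seq ψ τ i , seq? i

  -- The operand of `X` or `Xʷ` need not inherit well-formedness, but it is evaluated only at
  -- positive instants, where this condition is vacuous.
  Guarded : Fin (Trace.n τ) → ℒ S → Set
  Guarded i φ = toℕ i ≡ 0 → WellFormed φ

  next-guarded : ∀ {i : Fin (Trace.n τ)} (lt : suc (toℕ i) < Trace.n τ) φ →
                 Guarded (fromℕ< lt) φ
  next-guarded lt φ eq with trans (sym (toℕ-fromℕ< lt)) eq
  ... | ()

  reflects-atom : ∀ i a → a ∈ foa ψ → (toℕ i ≡ 0 → ¬ HasLookbackᵃ a) →
                  Reflects (HoldsAtom τ i a) (member? ⌊ a ⌋ (σ i))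
  reflects-atom i a a∈ψ ¬lb =
    reflects-map (seq⇔HoldsAtom ψ τ i a a∈ψ ¬lb) (proof (seq? i a))

  -- Lexicographic induction on `Rest`, then on `φ`: `U` and `R` reappear unchanged, but with fewer
  -- instants left. The inclusion of atoms is carried along because `seq` is formed from the fixed
  -- root `ψ`.
  reflects-⁺ : ∀ {i ρ} → Rest σ i ρ → ∀ φ → foa φ ⊆ foa ψ → Guarded i φ →
               Reflects (Holds τ i φ) (value ν (embed φ ⁺⟨ σ i ∷ ρ ⟩))
  -- The list is `ρ` alone, since the guard arises only when `σ i` is consumed.
  reflects-nextˢ : ∀ {i ρ} → Rest σ i ρ → ∀ φ → foa φ ⊆ foa ψ →
                   Reflects (Holds τ i (X φ)) (value ν (nextˢ (embed φ) ⁺⟨ ρ ⟩))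
  reflects-nextʷ : ∀ {i ρ} → Rest σ i ρ → ∀ φ → foa φ ⊆ foa ψ →
                   Reflects (Holds τ i (Xʷ φ)) (value ν (nextʷ (embed φ) ⁺⟨ ρ ⟩))

  -- No set is left to consume, so `ν-last` makes the guard `¬atom last` false.
  reflects-nextˢ (final eq) φ φ⊆ψ
    rewrite ν-last | ∧-zeroʳ (value ν (embed φ)) =
    ofⁿ λ { (lt , _) → <-irrefl eq lt }
  -- The guard meets a further set, which never contains `last`, so it progresses to `⊤`, the unit
  -- of the conjunction.
  reflects-nextˢ (step {ρ} lt r) φ φ⊆ψ
    rewrite value-∧ ν ρ (embed φ ⁺[ σ (fromℕ< lt) ]) ⊤ | value-⊤ ν ρ
          | ∧-identityʳ (value ν (embed φ ⁺⟨ σ (fromℕ< lt) ∷ ρ ⟩)) =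
    reflects-map (mk⇔ (lt ,_) proj₂) (reflects-⁺ r φ φ⊆ψ (next-guarded lt φ))

  reflects-nextʷ (final eq) φ φ⊆ψ
    rewrite ν-last | ∨-zeroʳ (value ν (embed φ)) = ofʸ (inj₁ eq)
  reflects-nextʷ (step {ρ} lt r) φ φ⊆ψ
    rewrite value-∨ ν ρ (embed φ ⁺[ σ (fromℕ< lt) ]) ⊥ | value-⊥ ν ρ
          | ∨-identityʳ (value ν (embed φ ⁺⟨ σ (fromℕ< lt) ∷ ρ ⟩)) =
    reflects-map (mk⇔ (λ h → inj₂ (lt , h))
                      [ (λ eq → contradiction lt (<-irrefl eq)) , proj₂ ])
                 (reflects-⁺ r φ φ⊆ψ (next-guarded lt φ))

  reflects-⁺ {ρ = ρ} r ⊤ φ⊆ψ g rewrite value-⊤ ν ρ = ofʸ tt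
  reflects-⁺ {ρ = ρ} r ⊥ φ⊆ψ g rewrite value-⊥ ν ρ = ofⁿ id
  reflects-⁺ {i} {ρ} r (atom a) φ⊆ψ g
    rewrite value-if ν ρ (member? ⌊ a ⌋ (σ i)) =
    reflects-atom i a (φ⊆ψ (here refl)) (λ i≡0 → g i≡0 a (inj₁ (here refl)))
  reflects-⁺ {i} {ρ} r (¬atom a) φ⊆ψ g
    rewrite value-if-not ν ρ (member? ⌊ a ⌋ (σ i)) =
    ¬-reflects (reflects-atom i a (φ⊆ψ (here refl)) (λ i≡0 → g i≡0 a (inj₂ (here refl))))
  reflects-⁺ {i} {ρ} r (φ ∧ χ) φ⊆ψ g =
    reflects-∧ ν (σ i ∷ ρ) (embed φ) (embed χ)
      (reflects-⁺ r φ (φ⊆ψ ∘ ∈-++⁺ˡ) (wf-∧ˡ φ χ ∘ g))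
      (reflects-⁺ r χ (φ⊆ψ ∘ ∈-++⁺ʳ (foa φ)) (wf-∧ʳ φ χ ∘ g))
  reflects-⁺ {i} {ρ} r (φ ∨ χ) φ⊆ψ g =
    reflects-∨ ν (σ i ∷ ρ) (embed φ) (embed χ)
      (reflects-⁺ r φ (φ⊆ψ ∘ ∈-++⁺ˡ) (wf-∧ˡ φ χ ∘ g))
      (reflects-⁺ r χ (φ⊆ψ ∘ ∈-++⁺ʳ (foa φ)) (wf-∧ʳ φ χ ∘ g))
  reflects-⁺ r (X φ)  φ⊆ψ g = reflects-nextˢ r φ φ⊆ψ
  reflects-⁺ r (Xʷ φ) φ⊆ψ g = reflects-nextʷ r φ φ⊆ψ
  reflects-⁺ {i} {ρ} r (φ U χ) φ⊆ψ g =
    -- Progression by `σ i` has already computed to the expansion; only `ρ` remains for its outer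
    -- connectives.
    reflects-map (U-unfold τ i φ χ)
      (reflects-∨ ν ρ (embed χ ⁺[ σ i ]) (embed φ ⁺[ σ i ] ∧ nextˢ (embed (φ U χ)))
        (reflects-⁺ r χ (φ⊆ψ ∘ ∈-++⁺ʳ (foa φ)) (wf-Uʳ φ χ ∘ g))
        (reflects-∧ ν ρ (embed φ ⁺[ σ i ]) (nextˢ (embed (φ U χ)))
          (reflects-⁺ r φ (φ⊆ψ ∘ ∈-++⁺ˡ) (wf-Uˡ φ χ ∘ g))
          (reflects-nextˢ r (φ U χ) φ⊆ψ)))
  reflects-⁺ {i} {ρ} r (φ R χ) φ⊆ψ g =
    reflects-map (R-unfold τ i φ χ)
      (reflects-∧ ν ρ (embed χ ⁺[ σ i ]) (embed φ ⁺[ σ i ] ∨ nextʷ (embed (φ R χ)))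
        (reflects-⁺ r χ (φ⊆ψ ∘ ∈-++⁺ʳ (foa φ)) (wf-Rʳ φ χ ∘ g))
        (reflects-∨ ν ρ (embed φ ⁺[ σ i ]) (nextʷ (embed (φ R χ)))
          (reflects-⁺ r φ (φ⊆ψ ∘ ∈-++⁺ˡ) (wf-Rˡ φ χ ∘ g))
          (reflects-nextʷ r (φ R χ) φ⊆ψ)))

theorem1 : (S : Signature) (ψ : ℒ S) → WellFormed ψ → (τ : Trace S) →
    (seq? : ∀ i → Decidable (seq ψ τ i)) →
    let σ = tabulate (λ i → seq ψ τ i , seq? i) in
    (atom last ⊩ embed ψ ⁺⟨ σ ⟩ ≡ₚ ⊤) ⇔ (τ ⊨ ψ)
theorem1 S ψ wf τ seq? =
  -- Every valuation with `last` true reflects satisfaction, so a single instance suffices; the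
  -- constantly true one is such.
  mk⇔ (λ equiv → invert (subst (Reflects _) (equiv (λ _ → true) refl)
                               (reflects (λ _ → true) refl)))
      (λ holds ν ν-last → reflects-true (reflects ν ν-last) holds)
  where
  reflects : ∀ ν → ν (atom last) ≡ true → _
  reflects ν ν-last =
    -- `tabulate σ` unfolds to `σ zero` followed by the list that `rest-tabulate` covers.
    reflects-⁺ (rest-tabulate (Trace.n-1 τ) σ) ψ id (λ _ → wf)
    where open Progression ψ τ seq? ν ν-last
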